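{- The minimum size $f(d)$ of a double cover of $\{0,1,2\}^d$ satisfies $$f(4)\ge 19,\quad f(5)\ge 33,\quad f(6)\ge 57,\quad f(7)\ge 97,\quad f(8)\ge 164.$$
   Context: Write $[3]=\{0,1,2\}$. A proper sub-box of $[3]^d$ is a set $B=S_1\times\dots\times S_d$ with $\varnothing\neq S_i\subsetneq[3]$ for every $1\le i\le d$ (so each side $S_i$ has one or two elements). A double cover of $[3]^d$ is a finite multiset $\{B_1,\dots,B_m\}$ of proper sub-boxes such that every point of $[3]^d$ lies in exactly two of the $B_j$, counted with multiplicity; its size is $m$. $f(d)$ denotes the minimum size of a double cover of $[3]^d$. The base value $f(3)=11$ is taken as known (it is established by exhaustive computation). -}

module Defs where

open import Data.Bool.Base using (true; false)
open import Data.Fin.Base using (Fin; zero; suc)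
import Data.Fin.Properties as Fin
open import Data.Fin.Subset using (Subset; inside; outside; ⊤; _∈_; _∉_; _⊂_; Nonempty)
open import Data.Fin.Subset.Properties using (_∈?_; _⊂?_; nonempty?; anySubset?; ⊆⊤)
open import Data.List.Base using (List; []; _∷_; _++_; map; filter; length)
open import Data.List.Properties using (length-++; filter-++)
open import Data.List.Relation.Unary.All as All using (All; []; _∷_)
open import Data.List.Relation.Unary.All.Properties using (map⁺; ++⁺)
open import Data.Nat.Base using (ℕ; zero; suc; _+_; _≤_; z≤n; s≤s)
import Data.Nat.Properties as ℕ
open import Data.Product.Base using (∃; _×_; _,_; proj₁; proj₂)
open import Data.Vec.Base as Vec using (Vec; []; _∷_; here; there)
open import Data.Vec.Properties using (length-toList; toList∘fromList)
open import Data.Vec.Relation.Binary.Pointwise.Inductive as Pointwise using (Pointwise; []; _∷_)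
open import Data.Vec.Relation.Unary.All as VecAll using ([]; _∷_)
open import Relation.Binary.PropositionalEquality using (_≡_; refl; sym; trans; cong; cong₂; subst)
open import Relation.Nullary using (Dec; yes; no; does; contradiction)
open import Relation.Nullary.Decidable using (map′; _×-dec_)
open import Relation.Unary using (Decidable)

Point : ℕ → Set
Point d = Vec (Fin 3) d

-- A box S₁ × … × S_d is given by its sides.  Boxes with nonempty sides are
-- equal as sets exactly when their sides agree.
Box : ℕ → Set
Box d = Vec (Subset 3) d

Proper : ∀ {d} → Box d → Set
Proper = VecAll.All (λ S → Nonempty S × S ⊂ ⊤)

infix 4 _∈ᴮ_ _∈ᴮ?_

_∈ᴮ_ : ∀ {d} → Point d → Box d → Set
p ∈ᴮ B = Pointwise _∈_ p B

_∈ᴮ?_ : ∀ {d} (p : Point d) (B : Box d) → Dec (p ∈ᴮ B)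
_∈ᴮ?_ = Pointwise.decidable _∈?_

-- The number of boxes containing p, where a finite multiset of boxes is
-- presented as a list, in any order and with repetitions.
multiplicity : ∀ {d} → Point d → List (Box d) → ℕ
multiplicity p Bs = length (filter (p ∈ᴮ?_) Bs)

IsDoubleCover : ∀ {d} → List (Box d) → Set
IsDoubleCover Bs = All Proper Bs × (∀ p → multiplicity p Bs ≡ 2)

DoubleCoverOfSize : ℕ → ℕ → Set
DoubleCoverOfSize d m = ∃ λ (Bs : List (Box d)) → length Bs ≡ m × IsDoubleCover Bs

IsMinimum : (ℕ → Set) → ℕ → Set
IsMinimum P m = P m × (∀ n → P n → m ≤ n)

------------------------------------------------------------------------
-- Whether a double cover of a given size exists is decidable, by searching
-- the finitely many lists of boxes of that size.

anyVec? : ∀ {A : Set} → (∀ {P : A → Set} → Decidable P → Dec (∃ P)) →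
          ∀ n {P : Vec A n → Set} → Decidable P → Dec (∃ P)
anyVec? any? zero    P? = map′ ([] ,_) (λ { ([] , p) → p }) (P? [])
anyVec? any? (suc n) P? =
  map′ (λ { (x , xs , p) → x ∷ xs , p }) (λ { (x ∷ xs , p) → x , xs , p })
       (any? (λ x → anyVec? any? n (λ xs → P? (x ∷ xs))))

allVec? : ∀ {A : Set} → (∀ {P : A → Set} → Decidable P → Dec (∀ x → P x)) →
          ∀ n {P : Vec A n → Set} → Decidable P → Dec (∀ xs → P xs)
allVec? all? zero    P? = map′ (λ { p [] → p }) (λ p → p []) (P? [])
allVec? all? (suc n) P? =
  map′ (λ { p (x ∷ xs) → p x xs }) (λ p x xs → p (x ∷ xs))
       (all? (λ x → allVec? all? n (λ xs → P? (x ∷ xs))))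

isDoubleCover? : ∀ {d} → Decidable (IsDoubleCover {d})
isDoubleCover? {d} Bs =
  All.all? (VecAll.all? (λ S → nonempty? S ×-dec S ⊂? ⊤)) Bs
  ×-dec allVec? Fin.all? d (λ p → multiplicity p Bs ℕ.≟ 2)

doubleCoverOfSize? : ∀ d → Decidable (DoubleCoverOfSize d)
doubleCoverOfSize? d m =
  map′ (λ { (Bs , c) → Vec.toList Bs , length-toList Bs , c })
       (λ { (Bs , refl , c) → Vec.fromList Bs , subst IsDoubleCover (sym (toList∘fromList Bs)) c })
       (anyVec? (anyVec? any? d) m (λ Bs → isDoubleCover? (Vec.toList Bs)))
  where
  any? : ∀ {P : Subset 3 → Set} → Decidable P → Dec (∃ P)
  any? = anySubset?

------------------------------------------------------------------------
-- A double cover exists in every dimension: take twice the partition of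
-- [3]ᵈ into products of the sides {0,1} and {2}.

private
  pattern ⟨01⟩ = inside ∷ inside ∷ outside ∷ []
  pattern ⟨2⟩  = outside ∷ outside ∷ inside ∷ []

bricks : ∀ d → List (Box d)
bricks zero    = [] ∷ []
bricks (suc d) = map (⟨01⟩ ∷_) (bricks d) ++ map (⟨2⟩ ∷_) (bricks d)

bricks-proper : ∀ d → All Proper (bricks d)
bricks-proper zero    = [] ∷ []
bricks-proper (suc d) =
  ++⁺ (map⁺ (All.map (((zero , here) , ⊆⊤ , suc (suc zero) , there (there here) , λ { (there (there ())) }) ∷_) (bricks-proper d)))
      (map⁺ (All.map (((suc (suc zero) , there (there here)) , ⊆⊤ , zero , here , λ ()) ∷_) (bricks-proper d)))

multiplicity-++ : ∀ {d} (p : Point d) Bs Cs →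
                  multiplicity p (Bs ++ Cs) ≡ multiplicity p Bs + multiplicity p Cs
multiplicity-++ p Bs Cs =
  trans (cong length (filter-++ (p ∈ᴮ?_) Bs Cs)) (length-++ (filter (p ∈ᴮ?_) Bs))

multiplicity-map-∈ : ∀ {d x S} → x ∈ S → ∀ (p : Point d) Bs →
                     multiplicity (x ∷ p) (map (S ∷_) Bs) ≡ multiplicity p Bs
multiplicity-map-∈ x∈S p []       = refl
multiplicity-map-∈ {x = x} {S} x∈S p (B ∷ Bs) with x ∈? S | does (p ∈ᴮ? B)
... | yes _  | true  = cong suc (multiplicity-map-∈ x∈S p Bs)
... | yes _  | false = multiplicity-map-∈ x∈S p Bs
... | no x∉S | _     = contradiction x∈S x∉S

multiplicity-map-∉ : ∀ {d x S} → x ∉ S → ∀ (p : Point d) Bs →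
                     multiplicity (x ∷ p) (map (S ∷_) Bs) ≡ 0
multiplicity-map-∉ x∉S p []       = refl
multiplicity-map-∉ {x = x} {S} x∉S p (B ∷ Bs) with x ∈? S
... | yes x∈S = contradiction x∈S x∉S
... | no _    = multiplicity-map-∉ x∉S p Bs

bricks-partition : ∀ {d} (p : Point d) → multiplicity p (bricks d) ≡ 1
bricks-partition []                = refl
bricks-partition {suc d} (x ∷ p) =
  trans (multiplicity-++ (x ∷ p) (map (⟨01⟩ ∷_) (bricks d)) _) (lemma x)
  where
  in-one : ∀ {x S} → x ∈ S → multiplicity (x ∷ p) (map (S ∷_) (bricks d)) ≡ 1
  in-one x∈S = trans (multiplicity-map-∈ x∈S p (bricks d)) (bricks-partition p)
  lemma : ∀ x → multiplicity (x ∷ p) (map (⟨01⟩ ∷_) (bricks d))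
              + multiplicity (x ∷ p) (map (⟨2⟩ ∷_) (bricks d)) ≡ 1
  lemma zero             = cong₂ _+_ (in-one here) (multiplicity-map-∉ (λ ()) p (bricks d))
  lemma (suc zero)       = cong₂ _+_ (in-one (there here)) (multiplicity-map-∉ (λ { (there ()) }) p (bricks d))
  lemma (suc (suc zero)) = cong₂ _+_ (multiplicity-map-∉ (λ { (there (there ())) }) p (bricks d))
                                     (in-one (there (there here)))

doubleCover-exists : ∀ d → ∃ (DoubleCoverOfSize d)
doubleCover-exists d = _ , bricks d ++ bricks d , refl , ++⁺ (bricks-proper d) (bricks-proper d) ,
  λ p → trans (multiplicity-++ p (bricks d) (bricks d)) (cong₂ _+_ (bricks-partition p) (bricks-partition p))

------------------------------------------------------------------------

least : ∀ {P : ℕ → Set} → Decidable P → ∀ n → P n → ∃ (IsMinimum P)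
least {P} P? n Pn with P? 0
... | yes P0 = 0 , P0 , λ _ _ → z≤n
least P? zero    P0 | no ¬P0 = contradiction P0 ¬P0
least P? (suc n) Pn | no ¬P0 with least (λ k → P? (suc k)) n Pn
... | m , Pm , m≤ = suc m , Pm , λ { zero P0 → contradiction P0 ¬P0 ; (suc k) Pk → s≤s (m≤ k Pk) }

-- f is abstract only to keep the type checker from running the search;
-- f-isMinimum determines it.
abstract
  f : ℕ → ℕ
  f d = proj₁ (least (doubleCoverOfSize? d) _ (proj₂ (doubleCover-exists d)))

  f-isMinimum : ∀ d → IsMinimum (DoubleCoverOfSize d) (f d)
  f-isMinimum d = proj₂ (least (doubleCoverOfSize? d) _ (proj₂ (doubleCover-exists d)))

{-# OPTIONS --safe #-}
module Submission where

-- A box with k two-element sides has perimeter (sum of the side lengths) d + k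
-- and volume 2ᵏ.  Fixing one coordinate of a double cover to any of its three
-- values leaves a double cover of [3]ᵈ⁻¹, so the sides in that direction have
-- total length at least 3 f(d-1) and the perimeters add up to at least
-- 3d f(d-1), while the volumes add up to 2 · 3ᵈ.  Both totals together bound
-- the number of boxes through the convexity inequality k ≤ j - 1 + 2ᵏ⁻ʲ, taken
-- at j = 3, 3, 4, 5, 6 for d = 4, …, 8.  For d = 6 this barely fails;
-- there 4 does not divide 2 · 3⁶, so some box has k ≤ 1, far off the tangent.

open import Defs
open import Algebra.Properties.CommutativeSemigroup using (interchange)
open import Data.Bool.Base using (Bool; true; false)
open import Data.Fin.Base using (Fin; zero; suc)
open import Data.Fin.Patterns using (0F; 1F; 2F)
open import Data.Fin.Subset using (Subset; ⊤; _∈_; _⊂_; Nonempty; ∣_∣)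
open import Data.Fin.Subset.Properties using (_∈?_; p⊂q⇒∣p∣<∣q∣; x∈p⇒∣p-x∣<∣p∣)
open import Data.List.Base using (List; []; _∷_; map; filter; length)
open import Data.List.Relation.Unary.All as All using (All; []; _∷_)
open import Data.List.Relation.Unary.All.Properties using (map⁺; filter⁺; ¬All⇒Any¬)
open import Data.List.Relation.Unary.Any using (Any; here; there)
open import Data.Nat.Base using (ℕ; zero; suc; _+_; _*_; _^_; _≤_; _<_; _≥_; z≤n; s≤s)
open import Data.Nat.Divisibility using (_∣_; _∤_; _∣?_; _∣0; ∣m∣n⇒∣m+n; m∣m*n)
open import Data.Nat.ListAction using (sum)
open import Data.Nat.Properties
open import Data.Nat.Tactic.RingSolver using (solve-∀)
open import Data.Product.Base using (∃; _×_; _,_; proj₁; proj₂)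
open import Data.Sum.Base using (inj₁; inj₂)
open import Data.Vec.Base as Vec using ([]; _∷_; lookup; insertAt; removeAt)
open import Data.Vec.Relation.Binary.Pointwise.Inductive using ([]; _∷_)
open import Data.Vec.Relation.Unary.All using ([]; _∷_)
open import Function.Bundles using (_⇔_; mk⇔)
open import Relation.Binary.PropositionalEquality using (_≡_; refl; sym; trans; cong; cong₂; subst; module ≡-Reasoning)
open import Relation.Nullary using (does; contradiction)
open import Relation.Nullary.Decidable using (does-⇔; from-no; from-yes; _×-dec_)
open import Relation.Unary using (Decidable)

private
  variable
    A B : Set
    d : ℕ

-- Sums over lists and their comparison

sumOver : (A → ℕ) → List A → ℕ
sumOver g xs = sum (map g xs)

sumOver-+ : ∀ (g h : A → ℕ) xs → sumOver (λ x → g x + h x) xs ≡ sumOver g xs + sumOver h xs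
sumOver-+ g h []       = refl
sumOver-+ g h (x ∷ xs) rewrite sumOver-+ g h xs = interchange +-commutativeSemigroup (g x) (h x) (sumOver g xs) (sumOver h xs)

sumOver-* : ∀ c (g : A → ℕ) xs → sumOver (λ x → c * g x) xs ≡ c * sumOver g xs
sumOver-* c g []       = sym (*-zeroʳ c)
sumOver-* c g (x ∷ xs) rewrite sumOver-* c g xs = sym (*-distribˡ-+ c (g x) _)

sumOver-const : ∀ c (xs : List A) → sumOver (λ _ → c) xs ≡ length xs * c
sumOver-const c []       = refl
sumOver-const c (x ∷ xs) = cong (c +_) (sumOver-const c xs)

sumOver-mono : ∀ {g h : A → ℕ} {xs} → All (λ x → g x ≤ h x) xs → sumOver g xs ≤ sumOver h xs
sumOver-mono []       = z≤n
sumOver-mono (p ∷ ps) = +-mono-≤ p (sumOver-mono ps)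

-- A surplus `e` at one entry survives in the total, because no other entry loses anything. It
-- serves to exploit a single box that lies far off the tangent.
sumOver-mono-gap : ∀ {g h : A → ℕ} e {xs} → All (λ x → g x ≤ h x) xs →
                   Any (λ x → g x + e ≤ h x) xs → sumOver g xs + e ≤ sumOver h xs
sumOver-mono-gap {g = g} {h} e {x ∷ xs} (_ ∷ ps) (here q) = begin
  g x + sumOver g xs + e    ≡⟨ +-assoc (g x) _ e ⟩
  g x + (sumOver g xs + e)  ≡⟨ cong (g x +_) (+-comm _ e) ⟩
  g x + (e + sumOver g xs)  ≡⟨ +-assoc (g x) e _ ⟨
  g x + e + sumOver g xs    ≤⟨ +-mono-≤ q (sumOver-mono ps) ⟩
  h x + sumOver h xs        ∎
  where open ≤-Reasoning
sumOver-mono-gap {g = g} {h} e {x ∷ xs} (p ∷ ps) (there q) = begin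
  g x + sumOver g xs + e    ≡⟨ +-assoc (g x) _ e ⟩
  g x + (sumOver g xs + e)  ≤⟨ +-mono-≤ p (sumOver-mono-gap e ps q) ⟩
  h x + sumOver h xs        ∎
  where open ≤-Reasoning

∣-sumOver : ∀ {c} {g : A → ℕ} {xs} → All (λ x → c ∣ g x) xs → c ∣ sumOver g xs
∣-sumOver []       = _ ∣0
∣-sumOver (p ∷ ps) = ∣m∣n⇒∣m+n p (∣-sumOver ps)

length-filter-map-filter :
  ∀ {P Q : A → Set} {R : B → Set} (P? : Decidable P) (Q? : Decidable Q) (R? : Decidable R)
  (h : A → B) → (∀ x → P x ⇔ (Q x × R (h x))) →
  ∀ xs → length (filter R? (map h (filter Q? xs))) ≡ length (filter P? xs)
length-filter-map-filter P? Q? R? h P⇔ []       = refl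
length-filter-map-filter P? Q? R? h P⇔ (x ∷ xs)
  with ih ← length-filter-map-filter P? Q? R? h P⇔ xs
  -- The decision for `P` becomes the conjunction of those for `Q` and `R`, so both filters are
  -- governed by the same two booleans.
  rewrite does-⇔ (P⇔ x) (P? x) (Q? x ×-dec R? (h x))
  with does (Q? x)
... | false = ih
... | true with does (R? (h x))
...   | false = ih
...   | true  = cong suc ih

-- Slices of a cover in a coordinate direction

slice : Fin (suc d) → Fin 3 → List (Box (suc d)) → List (Box d)
slice i a Bs = map (λ B → removeAt B i) (filter (λ B → a ∈? lookup B i) Bs)

insertAt-∈ᴮ : ∀ i a (p : Point d) B →
              insertAt p i a ∈ᴮ B ⇔ (a ∈ lookup B i × p ∈ᴮ removeAt B i)
insertAt-∈ᴮ i a p B = mk⇔ (to i p B) (from i p B)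
  where
  to : ∀ {d} i (p : Point d) B → insertAt p i a ∈ᴮ B → a ∈ lookup B i × p ∈ᴮ removeAt B i
  to zero    p       (S ∷ B)     (a∈S ∷ p∈B) = a∈S , p∈B
  to (suc i) (x ∷ p) (S ∷ T ∷ B) (x∈S ∷ q)   with to i p (T ∷ B) q
  ... | a∈ , p∈ = a∈ , x∈S ∷ p∈
  from : ∀ {d} i (p : Point d) B → a ∈ lookup B i × p ∈ᴮ removeAt B i → insertAt p i a ∈ᴮ B
  from zero    p       (S ∷ B)     (a∈S , p∈B)      = a∈S ∷ p∈B
  from (suc i) (x ∷ p) (S ∷ T ∷ B) (a∈ , x∈S ∷ p∈) = x∈S ∷ from i p (T ∷ B) (a∈ , p∈)

multiplicity-slice : ∀ i a (p : Point d) Bs →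
                     multiplicity p (slice i a Bs) ≡ multiplicity (insertAt p i a) Bs
multiplicity-slice i a p =
  length-filter-map-filter (insertAt p i a ∈ᴮ?_) (λ B → a ∈? lookup B i) (p ∈ᴮ?_)
    (λ B → removeAt B i) (insertAt-∈ᴮ i a p)

removeAt-proper : ∀ i {B : Box (suc d)} → Proper B → Proper (removeAt B i)
removeAt-proper zero    (_ ∷ ps)     = ps
removeAt-proper (suc i) (p ∷ q ∷ ps) = p ∷ removeAt-proper i (q ∷ ps)

slice-cover : ∀ i a {Bs : List (Box (suc d))} → IsDoubleCover Bs → IsDoubleCover (slice i a Bs)
slice-cover i a {Bs} (proper , twice) =
  map⁺ (All.map (removeAt-proper i) (filter⁺ (λ B → a ∈? lookup B i) proper)) ,
  λ p → trans (multiplicity-slice i a p Bs) (twice (insertAt p i a))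

ι : Bool → ℕ
ι true  = 1
ι false = 0

∣S∣≡Σι : ∀ (S : Subset 3) → ∣ S ∣ ≡ ι (does (0F ∈? S)) + ι (does (1F ∈? S)) + ι (does (2F ∈? S))
∣S∣≡Σι (true  ∷ true  ∷ true  ∷ []) = refl
∣S∣≡Σι (true  ∷ true  ∷ false ∷ []) = refl
∣S∣≡Σι (true  ∷ false ∷ true  ∷ []) = refl
∣S∣≡Σι (true  ∷ false ∷ false ∷ []) = refl
∣S∣≡Σι (false ∷ true  ∷ true  ∷ []) = refl
∣S∣≡Σι (false ∷ true  ∷ false ∷ []) = refl
∣S∣≡Σι (false ∷ false ∷ true  ∷ []) = refl
∣S∣≡Σι (false ∷ false ∷ false ∷ []) = refl

sumOver-slice-∷ : ∀ i a (g : Box d → ℕ) B Bs → sumOver g (slice i a (B ∷ Bs)) ≡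
                  ι (does (a ∈? lookup B i)) * g (removeAt B i) + sumOver g (slice i a Bs)
sumOver-slice-∷ i a g B Bs with does (a ∈? lookup B i)
... | true  = cong (_+ sumOver g (slice i a Bs)) (sym (*-identityˡ (g (removeAt B i))))
... | false = refl

-- Double counting: a box survives in one slice for each element of its side in direction `i`,
-- always with the same remaining box. Taking `g` constant 1 yields total side lengths, taking
-- `g = volume` the inductive step for volumes.
sumOver-slices : ∀ i (g : Box d → ℕ) Bs →
  sumOver g (slice i 0F Bs) + sumOver g (slice i 1F Bs) + sumOver g (slice i 2F Bs)
  ≡ sumOver (λ B → ∣ lookup B i ∣ * g (removeAt B i)) Bs
sumOver-slices i g []       = refl
sumOver-slices i g (B ∷ Bs)
  rewrite sumOver-slice-∷ i 0F g B Bs | sumOver-slice-∷ i 1F g B Bs | sumOver-slice-∷ i 2F g B Bs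
        | ∣S∣≡Σι (lookup B i) | sym (sumOver-slices i g Bs)
  = regroup (ι (does (0F ∈? lookup B i))) (ι (does (1F ∈? lookup B i)))
            (ι (does (2F ∈? lookup B i))) (g (removeAt B i)) _ _ _
  where
  regroup : ∀ a b c x s t u →
    (a * x + s) + (b * x + t) + (c * x + u) ≡ (a + b + c) * x + (s + t + u)
  regroup = solve-∀

-- Total volume and total perimeter

perimeter volume : Box d → ℕ
perimeter []      = 0
perimeter (S ∷ B) = ∣ S ∣ + perimeter B
volume []      = 1
volume (S ∷ B) = ∣ S ∣ * volume B

-- Induction on the dimension: each of the three slices in the first direction again has constant
-- multiplicity `c`, and `sumOver-slices` reassembles their volumes. In dimension 0 the volume total
-- simply counts the boxes.
total-volume : ∀ c (Bs : List (Box d)) → (∀ p → multiplicity p Bs ≡ c) →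
               sumOver volume Bs ≡ c * 3 ^ d
total-volume {zero} c Bs mult =
  trans (points Bs) (trans (mult []) (sym (*-identityʳ c)))
  where
  points : ∀ Bs → sumOver volume Bs ≡ multiplicity [] Bs
  points []        = refl
  points ([] ∷ Bs) = cong suc (points Bs)
total-volume {suc d} c Bs mult = trans (heads Bs) (trans (sym (sumOver-slices 0F volume Bs)) (begin
  V 0F + V 1F + V 2F                ≡⟨ cong₂ _+_ (cong₂ _+_ (V≡ 0F) (V≡ 1F)) (V≡ 2F) ⟩
  c * 3 ^ d + c * 3 ^ d + c * 3 ^ d ≡⟨ triple c (3 ^ d) ⟩
  c * 3 ^ suc d                     ∎))
  where
  open ≡-Reasoning
  V : Fin 3 → ℕ
  V a = sumOver volume (slice 0F a Bs)
  V≡ : ∀ a → V a ≡ c * 3 ^ d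
  V≡ a = total-volume c (slice 0F a Bs) λ p → trans (multiplicity-slice 0F a p Bs) (mult (a ∷ p))
  heads : ∀ Bs → sumOver volume Bs ≡ sumOver (λ B → ∣ lookup B 0F ∣ * volume (removeAt B 0F)) Bs
  heads []             = refl
  heads ((S ∷ B) ∷ Bs) = cong (∣ S ∣ * volume B +_) (heads Bs)
  triple : ∀ c t → c * t + c * t + c * t ≡ c * (3 * t)
  triple = solve-∀

-- Exchanges summation over boxes with summation over directions, peeling off the first direction at
-- each step.
total-perimeter : ∀ {n} (Bs : List (Box d)) → (∀ i → n ≤ sumOver (λ B → ∣ lookup B i ∣) Bs) →
                  d * n ≤ sumOver perimeter Bs
total-perimeter {zero}      Bs n≤ = z≤n
total-perimeter {suc d} {n} Bs n≤ = begin
  n + d * n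
    ≤⟨ +-mono-≤ (n≤ 0F) (total-perimeter (map Vec.tail Bs) tails≤) ⟩
  sumOver (λ B → ∣ lookup B 0F ∣) Bs + sumOver perimeter (map Vec.tail Bs)
    ≡⟨ split Bs ⟨
  sumOver perimeter Bs
    ∎
  where
  open ≤-Reasoning
  tails : ∀ i Bs → sumOver (λ B → ∣ lookup B (suc i) ∣) Bs ≡ sumOver (λ B → ∣ lookup B i ∣) (map Vec.tail Bs)
  tails i []             = refl
  tails i ((S ∷ B) ∷ Bs) = cong (∣ lookup B i ∣ +_) (tails i Bs)
  tails≤ : ∀ i → n ≤ sumOver (λ B → ∣ lookup B i ∣) (map Vec.tail Bs)
  tails≤ i = ≤-trans (n≤ (suc i)) (≤-reflexive (tails i Bs))
  split : ∀ (Bs : List (Box (suc d))) → sumOver perimeter Bs ≡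
          sumOver (λ B → ∣ lookup B 0F ∣) Bs + sumOver perimeter (map Vec.tail Bs)
  split []             = refl
  split ((S ∷ B) ∷ Bs) rewrite split Bs = interchange +-commutativeSemigroup ∣ S ∣ (perimeter B) _ _

f≤length : ∀ {Bs : List (Box d)} → IsDoubleCover Bs → f d ≤ length Bs
f≤length {d} {Bs} cover = proj₂ (f-isMinimum d) (length Bs) (Bs , refl , cover)

side-total : ∀ {Bs : List (Box (suc d))} → IsDoubleCover Bs → ∀ i →
             3 * f d ≤ sumOver (λ B → ∣ lookup B i ∣) Bs
side-total {d} {Bs} cover i = begin
  3 * f d
    ≡⟨ triple (f d) ⟩
  f d + f d + f d
    ≤⟨ +-mono-≤ (+-mono-≤ (f≤ 0F) (f≤ 1F)) (f≤ 2F) ⟩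
  size 0F + size 1F + size 2F
    -- The three slices are double covers one dimension lower; counting their boxes together counts
    -- each box of `Bs` once per element of its side.
    ≡⟨ sumOver-slices i (λ _ → 1) Bs ⟩
  sumOver (λ B → ∣ lookup B i ∣ * 1) Bs
    ≤⟨ sumOver-mono (All.universal (λ B → ≤-reflexive (*-identityʳ ∣ lookup B i ∣)) Bs) ⟩
  sumOver (λ B → ∣ lookup B i ∣) Bs
    ∎
  where
  open ≤-Reasoning
  size : Fin 3 → ℕ
  size a = sumOver (λ _ → 1) (slice i a Bs)
  f≤ : ∀ a → f d ≤ size a
  f≤ a = ≤-trans (f≤length (slice-cover i a cover))
                 (≤-reflexive (sym (trans (sumOver-const 1 (slice i a Bs)) (*-identityʳ _))))
  triple : ∀ x → 3 * x ≡ x + x + x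
  triple = solve-∀

-- Shape of a proper box and the tangent inequality

side-bounds : ∀ {S : Subset 3} → Nonempty S → S ⊂ ⊤ → 1 ≤ ∣ S ∣ × ∣ S ∣ ≤ 2
side-bounds (x , x∈S) S⊂⊤ = ≤-trans (s≤s z≤n) (x∈p⇒∣p-x∣<∣p∣ x∈S) , ≤-pred (p⊂q⇒∣p∣<∣q∣ S⊂⊤)

-- The witness `k` is the number of two-element sides.
shape : ∀ {B : Box d} → Proper B → ∃ λ k → perimeter B ≡ d + k × volume B ≡ 2 ^ k
shape []                     = 0 , refl , refl
shape {suc d} {S ∷ B} ((S≢∅ , S⊂⊤) ∷ ps) with ∣ S ∣ | side-bounds S≢∅ S⊂⊤ | shape ps
... | 1 | _                 | k , per , vol = k , cong suc per , trans (*-identityˡ _) vol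
... | 2 | _                 | k , per , vol =
  suc k , trans (cong (2 +_) per) (cong suc (sym (+-suc d k))) , cong (2 *_) vol
... | suc (suc (suc _)) | _ , s≤s (s≤s ()) | _

n<2^n : ∀ n → n < 2 ^ n
n<2^n zero    = s≤s z≤n
n<2^n (suc n) = +-mono-≤ (m^n>0 2 n) (≤-trans (n<2^n n) (m≤m+n (2 ^ n) 0))

-- This is `k + 1 ≤ j + 2 ^ (k - j)`, multiplied by `2 ^ j` to stay within the naturals. For `k < j`
-- the term `j` alone suffices; otherwise it is `n < 2 ^ n` at `n = k - j`. Equality holds at
-- `k = j` and `k = j + 1`.
tangent : ∀ j k → 2 ^ j * suc k ≤ 2 ^ j * j + 2 ^ k
tangent j k with <-≤-connex k j
... | inj₁ k<j = ≤-trans (*-monoʳ-≤ (2 ^ j) k<j) (m≤m+n _ _)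
... | inj₂ j≤k with o , refl ← m≤n⇒∃[o]m+o≡n j≤k = begin
  2 ^ j * suc (j + o)         ≡⟨ expand (2 ^ j) j o ⟩
  2 ^ j * j + 2 ^ j * suc o   ≤⟨ +-monoʳ-≤ (2 ^ j * j) (*-monoʳ-≤ (2 ^ j) (n<2^n o)) ⟩
  2 ^ j * j + 2 ^ j * 2 ^ o   ≡⟨ cong (2 ^ j * j +_) (^-distribˡ-+-* 2 j o) ⟨
  2 ^ j * j + 2 ^ (j + o)     ∎
  where
  open ≤-Reasoning
  expand : ∀ a j o → a * suc (j + o) ≡ a * j + a * suc o
  expand = solve-∀

-- The two sides of the tangent inequality at j, shifted by 2ʲ d.
linear convex : ℕ → Box d → ℕ
linear j B = 2 ^ j * suc (perimeter B)
convex {d} j B = 2 ^ j * (d + j) + volume B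

-- Carries an inequality about `k`, with surplus `e`, over to a box with `k` two-element sides by
-- adding `2 ^ j * d` to both sides.
linear≤convex : ∀ j e {k} {B : Box d} → perimeter B ≡ d + k → volume B ≡ 2 ^ k →
                2 ^ j * suc k + e ≤ 2 ^ j * j + 2 ^ k → linear j B + e ≤ convex j B
linear≤convex {d} j e {k} {B} per vol le = begin
  2 ^ j * suc (perimeter B) + e        ≡⟨ cong (λ x → 2 ^ j * suc x + e) per ⟩
  2 ^ j * suc (d + k) + e              ≡⟨ expandˡ (2 ^ j) d k e ⟩
  2 ^ j * d + (2 ^ j * suc k + e)      ≤⟨ +-monoʳ-≤ (2 ^ j * d) le ⟩
  2 ^ j * d + (2 ^ j * j + 2 ^ k)      ≡⟨ expandʳ (2 ^ j) d j (2 ^ k) ⟩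
  2 ^ j * (d + j) + 2 ^ k              ≡⟨ cong (2 ^ j * (d + j) +_) vol ⟨
  2 ^ j * (d + j) + volume B           ∎
  where
  open ≤-Reasoning
  expandˡ : ∀ a d k e → a * suc (d + k) + e ≡ a * d + (a * suc k + e)
  expandˡ = solve-∀
  expandʳ : ∀ a d j v → a * d + (a * j + v) ≡ a * (d + j) + v
  expandʳ = solve-∀

box-tangent : ∀ j {B : Box d} → Proper B → linear j B ≤ convex j B
box-tangent j {B} proper with k , per , vol ← shape proper =
  ≤-trans (m≤m+n _ 0) (linear≤convex j 0 {B = B} per vol (≤-trans (≤-reflexive (+-identityʳ _)) (tangent j k)))

-- 34 is the exact gap at k = 1; at k = 0 it is larger.
box-gap : ∀ {B : Box d} → Proper B → 4 ∤ volume B → linear 4 B + 34 ≤ convex 4 B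
box-gap {B = B} proper 4∤vol with shape proper
... | 0           , per , vol = linear≤convex 4 34 {B = B} per vol (from-yes (50 ≤? 65))
... | 1           , per , vol = linear≤convex 4 34 {B = B} per vol (from-yes (66 ≤? 66))
... | suc (suc k) , _   , vol =
  contradiction (subst (4 ∣_) (sym (trans vol (sym (*-assoc 2 2 (2 ^ k))))) (m∣m*n (2 ^ k))) 4∤vol

-- Averaging over a minimum cover

-- The slack `e` in the summed tangent inequality is a parameter, so that the plain bound (`e = 0`)
-- and its improvement by divisibility enter the same averaging argument.
Gap : ℕ → ℕ → ℕ → Set
Gap d j e = ∀ {Bs : List (Box d)} → IsDoubleCover Bs →
            sumOver (linear j) Bs + e ≤ sumOver (convex j) Bs

no-gap : ∀ j → Gap d j 0
no-gap j (proper , _) =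
  ≤-trans (≤-reflexive (+-identityʳ _)) (sumOver-mono (All.map (box-tangent j) proper))

-- If 4 divided every volume it would divide their total `2 * 3 ^ d`. Hence some box has volume 1 or
-- 2, and that box alone contributes the surplus 34.
parity-gap : 4 ∤ 2 * 3 ^ d → Gap d 4 34
parity-gap 4∤ {Bs} (proper , twice) =
  sumOver-mono-gap 34 (All.map (box-tangent 4) proper) (gaps proper odd)
  where
  odd : Any (λ B → 4 ∤ volume B) Bs
  odd = ¬All⇒Any¬ (λ B → 4 ∣? volume B) Bs
    (λ all → 4∤ (subst (4 ∣_) (total-volume 2 Bs twice) (∣-sumOver all)))
  gaps : ∀ {Bs} → All Proper Bs → Any (λ B → 4 ∤ volume B) Bs → Any (λ B → linear 4 B + 34 ≤ convex 4 B) Bs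
  gaps (p ∷ _)  (here 4∤vol) = here (box-gap p 4∤vol)
  gaps (_ ∷ ps) (there a)    = there (gaps ps a)

-- The summed tangent inequality for a cover of minimum size, with the perimeter total bounded below
-- and the volume total replaced by its exact value.
averaging : ∀ d j e → Gap (suc d) j e →
            2 ^ j * (suc d * (3 * f d)) + e ≤ f (suc d) * (2 ^ j * (d + j)) + 2 * 3 ^ suc d
averaging d j e gap with Bs , length≡f , cover@(_ , twice) ← proj₁ (f-isMinimum (suc d)) =
  subst (λ m → a * (suc d * (3 * f d)) + e ≤ m * (a * (d + j)) + v) length≡f
    -- The added `m * a` matches the `suc` in `linear` on the left and the `suc` of the dimension in
    -- `convex` on the right, which leaves the coefficient `d + j`.
    (+-cancelˡ-≤ (m * a) _ _ (begin
      m * a + (a * (suc d * (3 * f d)) + e)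
        ≡⟨ factor m a _ e ⟩
      a * (m * 1 + suc d * (3 * f d)) + e
        ≤⟨ +-monoˡ-≤ e (*-monoʳ-≤ a (+-monoʳ-≤ (m * 1) (total-perimeter Bs (side-total cover)))) ⟩
      a * (m * 1 + sumOver perimeter Bs) + e
        ≡⟨ cong (_+ e) linear-total ⟨
      sumOver (linear j) Bs + e
        ≤⟨ gap cover ⟩
      sumOver (convex j) Bs
        ≡⟨ convex-total ⟩
      m * (a * (suc d + j)) + v
        ≡⟨ peel m a (d + j) v ⟩
      m * a + (m * (a * (d + j)) + v)
        ∎))
  where
  open ≤-Reasoning
  a = 2 ^ j
  v = 2 * 3 ^ suc d
  m = length Bs
  linear-total : sumOver (linear j) Bs ≡ a * (m * 1 + sumOver perimeter Bs)
  linear-total = trans (sumOver-* a (λ B → suc (perimeter B)) Bs)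
    (cong (a *_) (trans (sumOver-+ (λ _ → 1) perimeter Bs)
                        (cong (_+ sumOver perimeter Bs) (sumOver-const 1 Bs))))
  convex-total : sumOver (convex j) Bs ≡ m * (a * (suc d + j)) + v
  convex-total = trans (sumOver-+ (λ _ → a * (suc d + j)) volume Bs)
    (cong₂ _+_ (sumOver-const (a * (suc d + j)) Bs) (total-volume 2 Bs twice))
  factor : ∀ m a p e → m * a + (a * p + e) ≡ a * (m * 1 + p) + e
  factor = solve-∀
  peel : ∀ m a x v → m * (a * suc x) + v ≡ m * a + (m * (a * x) + v)
  peel = solve-∀

-- If `f (suc d)` were at most `M`, `averaging` would contradict the numerical hypothesis. That
-- hypothesis involves only `F`, a lower bound for `f d`, so the bounds chain from one dimension to
-- the next.
f-step : ∀ d j e {F M} → Gap (suc d) j e → F ≤ f d →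
         M * (2 ^ j * (d + j)) + 2 * 3 ^ suc d < 2 ^ j * (suc d * (3 * F)) + e → M < f (suc d)
f-step d j e {F} {M} gap F≤ lt = ≰⇒> λ f≤M → <⇒≱ lt (begin
  2 ^ j * (suc d * (3 * F)) + e
    ≤⟨ +-monoˡ-≤ e (*-monoʳ-≤ (2 ^ j) (*-monoʳ-≤ (suc d) (*-monoʳ-≤ 3 F≤))) ⟩
  2 ^ j * (suc d * (3 * f d)) + e
    ≤⟨ averaging d j e gap ⟩
  f (suc d) * (2 ^ j * (d + j)) + 2 * 3 ^ suc d
    ≤⟨ +-monoˡ-≤ _ (*-monoˡ-≤ (2 ^ j * (d + j)) f≤M) ⟩
  M * (2 ^ j * (d + j)) + 2 * 3 ^ suc d
    ∎)
  where open ≤-Reasoning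

-- The numerical bounds in dimensions 4 to 8

theorem4p3 : f 3 ≡ 11 →
    f 4 ≥ 19 × f 5 ≥ 33 × f 6 ≥ 57 × f 7 ≥ 97 × f 8 ≥ 164
theorem4p3 f3≡11 = f4 , f5 , f6 , f7 , f8
  where
  f4 : f 4 ≥ 19
  -- `M` is one less than the claimed bound, here 18, and the check is 18 · 48 + 162 = 1026 < 1056.
  -- In each dimension `j` is chosen so that the average volume at the claimed size lies between
  -- `2 ^ j` and `2 ^ (j + 1)`, where the tangent inequality is tight.
  f4 = f-step 3 3 0 (no-gap 3) (≤-reflexive (sym f3≡11)) (<ᵇ⇒< _ _ _)
  f5 : f 5 ≥ 33
  f5 = f-step 4 3 0 (no-gap 3) f4 (<ᵇ⇒< _ _ _)
  f6 : f 6 ≥ 57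
  -- 1458 is `2 * 3 ^ 6`. With `M = 56` the left side is 9522, against only 9504 on the right
  -- without the gap; the surplus 34 raises this to 9538.
  f6 = f-step 5 4 34 (parity-gap (from-no (4 ∣? 1458))) f5 (<ᵇ⇒< _ _ _)
  f7 : f 7 ≥ 97
  f7 = f-step 6 5 0 (no-gap 5) f6 (<ᵇ⇒< _ _ _)
  f8 : f 8 ≥ 164
  f8 = f-step 7 6 0 (no-gap 6) f7 (<ᵇ⇒< _ _ _)
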